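{- Let $G$ and $H$ be graphs without isolated vertices. Then $G$ and $H$ are isomorphic as graphs if and only if $B(G)$ and $B(H)$ are isomorphic as $\mathbb{Z}_2$-posets, i.e. there is an order isomorphism $B(G)\to B(H)$ commuting with the involutions.
   Context: A graph $G$ is a set $V(G)$ together with a symmetric subset $E(G) \subset V(G)\times V(G)$ (undirected, no multiple edges, loops allowed; graphs may be infinite). For $v \in V(G)$, $N(v)=\{w : (v,w)\in E(G)\}$; $v$ is isolated if $N(v)=\emptyset$. The box complex $B(G)$ is the poset of all pairs $(\sigma,\tau)$ of non-empty (possibly infinite) subsets of $V(G)$ with $\sigma\times\tau\subset E(G)$, ordered by $(\sigma,\tau)\le(\sigma',\tau')$ iff $\sigma\subset\sigma'$ and $\tau\subset\tau'$, and equipped with the involution $(\sigma,\tau)\leftrightarrow(\tau,\sigma)$. -}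

module Defs where

open import Level using (Level; suc; _⊔_)
open import Data.Product.Base using (_×_; _,_; uncurry; swap)
open import Data.Product.Relation.Binary.Pointwise.NonDependent
  using (×-isPartialOrder)
open import Function.Bundles using (_⇔_; _↔_; Inverse)
open import Relation.Binary.Core using (Rel)
open import Relation.Binary.Bundles using (Poset)
open import Relation.Binary.Definitions using (Symmetric; Monotonic₁)
open import Relation.Binary.Structures using (IsPartialOrder)
open import Relation.Binary.Morphism.Structures using (IsOrderIsomorphism)
import Relation.Binary.Construct.On as On
open import Relation.Nullary.Negation.Core using (¬_)
open import Relation.Unary using (Pred; Empty; Satisfiable; _⊆_; _≐_; _⟨×⟩_)
open import Relation.Unary.Relation.Binary.Subset using (⊆-isPartialOrder)

-- E is read as a subset of V × V: only its inhabitation matters, never the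
-- identity of its proofs.
record Graph (ℓ : Level) : Set (suc ℓ) where
  field
    V     : Set ℓ
    E     : Rel V ℓ
    E-sym : Symmetric E

  N : V → Pred V ℓ
  N v w = E v w

  Isolated : V → Set ℓ
  Isolated v = Empty (N v)

NoIsolatedVertices : ∀ {ℓ} → Graph ℓ → Set ℓ
NoIsolatedVertices G = ∀ v → ¬ Isolated v
  where open Graph G

record GraphIso {ℓ : Level} (G H : Graph ℓ) : Set ℓ where
  private
    module G = Graph G
    module H = Graph H
  field
    bijection : G.V ↔ H.V

  open Inverse bijection public using (to; from)

  field
    edges : ∀ x y → G.E x y ⇔ H.E (to x) (to y)

-- A poset with an action of the two-element group by order-preserving maps.
record ℤ₂Poset (c ℓ₁ ℓ₂ : Level) : Set (suc (c ⊔ ℓ₁ ⊔ ℓ₂)) where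
  field
    poset : Poset c ℓ₁ ℓ₂

  open Poset poset public

  field
    ι            : Carrier → Carrier
    ι-monotone   : Monotonic₁ _≤_ _≤_ ι
    ι-involutive : ∀ x → ι (ι x) ≈ x

record ℤ₂PosetIso {c ℓ₁ ℓ₂ c′ ℓ₁′ ℓ₂′ : Level}
                  (P : ℤ₂Poset c ℓ₁ ℓ₂) (Q : ℤ₂Poset c′ ℓ₁′ ℓ₂′)
                  : Set (c ⊔ ℓ₁ ⊔ ℓ₂ ⊔ c′ ⊔ ℓ₁′ ⊔ ℓ₂′) where
  private
    module P = ℤ₂Poset P
    module Q = ℤ₂Poset Q
  field
    ⟦_⟧                : P.Carrier → Q.Carrier
    isOrderIsomorphism : IsOrderIsomorphism P._≈_ Q._≈_ P._≤_ Q._≤_ ⟦_⟧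
    equivariant        : ∀ x → ⟦ P.ι x ⟧ Q.≈ Q.ι ⟦ x ⟧

module _ {ℓ : Level} (G : Graph ℓ) where
  open Graph G

  record Box : Set (suc ℓ) where
    field
      σ τ        : Pred V ℓ
      σ-nonempty : Satisfiable σ
      τ-nonempty : Satisfiable τ
      complete   : (σ ⟨×⟩ τ) ⊆ uncurry E

  open Box

  -- Boxes are pairs of subsets, so equality is extensional equality of both
  -- components and disregards the remaining fields.
  _≈ᴮ_ : Rel Box ℓ
  b ≈ᴮ c = (σ b ≐ σ c) × (τ b ≐ τ c)

  _≤ᴮ_ : Rel Box ℓ
  b ≤ᴮ c = (σ b ⊆ σ c) × (τ b ⊆ τ c)

  ≤ᴮ-isPartialOrder : IsPartialOrder _≈ᴮ_ _≤ᴮ_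
  ≤ᴮ-isPartialOrder = On.isPartialOrder (λ b → σ b , τ b)
    (×-isPartialOrder ⊆-isPartialOrder ⊆-isPartialOrder)

  flip : Box → Box
  flip b = record
    { σ          = τ b
    ; τ          = σ b
    ; σ-nonempty = τ-nonempty b
    ; τ-nonempty = σ-nonempty b
    ; complete   = λ (x∈τ , y∈σ) → E-sym (complete b (y∈σ , x∈τ))
    }

  BoxComplex : ℤ₂Poset (suc ℓ) ℓ ℓ
  BoxComplex = record
    { poset        = record { isPartialOrder = ≤ᴮ-isPartialOrder }
    ; ι            = flip
    ; ι-monotone   = swap
    ; ι-involutive = λ b → IsPartialOrder.Eq.refl ≤ᴮ-isPartialOrder {b}
    }

{-# OPTIONS --safe #-}

-- The minimal boxes are the edges ({x},{y}), and the boxes with a singleton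
-- side can be recognised from the order.  Hence an isomorphism sends each star
-- ({x}, N x) to ({u}, N u) or to (N u, {u}) for some vertex u, and x ↦ u is the
-- required graph isomorphism: since the involution exchanges the two
-- possibilities, it does not matter that they may vary with the component of x.
-- Both occur at once only on a component that is a single edge or loop; there
-- the first one is preferred.
module Submission where

open import Defs
open import Axiom.ExcludedMiddle using (ExcludedMiddle)
open import Data.Product.Base using (Σ; ∃; ∃₂; _×_; _,_; proj₁; proj₂; swap)
import Data.Product.Base as Product
open import Data.Sum.Base using (_⊎_; inj₁; inj₂; [_,_]; reduce)
open import Function.Base using (_∘_; id)
open import Function.Bundles using (_⇔_; mk⇔; mk↔ₛ′; module Equivalence; module Inverse)
open import Level using (Level)
open import Relation.Binary.Morphism.Structures using (IsOrderIsomorphism)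
open import Relation.Binary.PropositionalEquality
  using (_≡_; _≢_; refl; sym; trans; subst; subst₂)
open import Relation.Nullary using (¬_; yes; no; contradiction)
open import Relation.Unary using (Pred; Satisfiable; _⊆_)

private variable
  ℓ c ℓ₁ ℓ₂ c′ ℓ₁′ ℓ₂′ : Level

-- Inverses and twists of isomorphisms of posets with involution

module Isomorphism {P : ℤ₂Poset c ℓ₁ ℓ₂} {Q : ℤ₂Poset c′ ℓ₁′ ℓ₂′}
                   (I : ℤ₂PosetIso P Q) where
  private
    module P = ℤ₂Poset P
    module Q = ℤ₂Poset Q
  open ℤ₂PosetIso I public
  open IsOrderIsomorphism isOrderIsomorphism public
    using (mono; cancel; injective; surjective)
    renaming (cong to ⟦⟧-cong)

  ⟦_⟧⁻¹ : Q.Carrier → P.Carrier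
  ⟦ y ⟧⁻¹ = proj₁ (surjective y)

  abstract
    inverseˡ : ∀ y → ⟦ ⟦ y ⟧⁻¹ ⟧ Q.≈ y
    inverseˡ y = proj₂ (surjective y) P.Eq.refl

    transpose-≤ : ∀ {x y} → ⟦ x ⟧ Q.≤ y → x P.≤ ⟦ y ⟧⁻¹
    transpose-≤ {y = y} fx≤y = cancel (Q.trans fx≤y (Q.reflexive (Q.Eq.sym (inverseˡ y))))

    transpose-≈ : ∀ {x y} → ⟦ x ⟧ Q.≈ y → ⟦ y ⟧⁻¹ P.≈ x
    transpose-≈ {y = y} fx≈y = injective (Q.Eq.trans (inverseˡ y) (Q.Eq.sym fx≈y))

  private abstract
    ι-cong : ∀ {x y} → x Q.≈ y → Q.ι x Q.≈ Q.ι y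
    ι-cong x≈y = Q.antisym (Q.ι-monotone (Q.reflexive x≈y))
                           (Q.ι-monotone (Q.reflexive (Q.Eq.sym x≈y)))

    ⟦⟧⁻¹-mono : ∀ {y z} → y Q.≤ z → ⟦ y ⟧⁻¹ P.≤ ⟦ z ⟧⁻¹
    ⟦⟧⁻¹-mono {y} y≤z = transpose-≤ (Q.trans (Q.reflexive (inverseˡ y)) y≤z)

    ⟦⟧⁻¹-cancel : ∀ {y z} → ⟦ y ⟧⁻¹ P.≤ ⟦ z ⟧⁻¹ → y Q.≤ z
    ⟦⟧⁻¹-cancel {y} {z} le = Q.trans (Q.reflexive (Q.Eq.sym (inverseˡ y)))
      (Q.trans (mono le) (Q.reflexive (inverseˡ z)))

    ⟦⟧⁻¹-cong : ∀ {y z} → y Q.≈ z → ⟦ y ⟧⁻¹ P.≈ ⟦ z ⟧⁻¹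
    ⟦⟧⁻¹-cong {z = z} y≈z = transpose-≈ (Q.Eq.trans (inverseˡ z) (Q.Eq.sym y≈z))

    ⟦⟧⁻¹-injective : ∀ {y z} → ⟦ y ⟧⁻¹ P.≈ ⟦ z ⟧⁻¹ → y Q.≈ z
    ⟦⟧⁻¹-injective {y} {z} eq = Q.Eq.trans (Q.Eq.sym (inverseˡ y))
      (Q.Eq.trans (⟦⟧-cong eq) (inverseˡ z))

  invert : ℤ₂PosetIso Q P
  invert = record
    { ⟦_⟧ = ⟦_⟧⁻¹
    ; isOrderIsomorphism = record
      { isOrderMonomorphism = record
        { isOrderHomomorphism = record { cong = ⟦⟧⁻¹-cong ; mono = ⟦⟧⁻¹-mono }
        ; injective = ⟦⟧⁻¹-injective
        ; cancel = ⟦⟧⁻¹-cancel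
        }
      ; surjective = λ x → ⟦ x ⟧ , λ z≈fx → transpose-≈ (Q.Eq.sym z≈fx)
      }
    ; equivariant = λ y → transpose-≈
        (Q.Eq.trans (equivariant ⟦ y ⟧⁻¹) (ι-cong (inverseˡ y)))
    }

  -- For box complexes this exchanges the two sides of every image, so that `star-image-σ` also
  -- covers images whose `τ` is a singleton.
  twist : ℤ₂PosetIso P Q
  twist = record
    { ⟦_⟧ = λ x → Q.ι ⟦ x ⟧
    ; isOrderIsomorphism = record
      { isOrderMonomorphism = record
        { isOrderHomomorphism = record
          { cong = ι-cong ∘ ⟦⟧-cong ; mono = Q.ι-monotone ∘ mono }
        ; injective = injective ∘ ι-injective
        ; cancel = cancel ∘ ι-cancel
        }
      ; surjective = λ y → ⟦ Q.ι y ⟧⁻¹ , λ z≈ → Q.Eq.trans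
          (ι-cong (Q.Eq.trans (⟦⟧-cong z≈) (inverseˡ (Q.ι y)))) (Q.ι-involutive y)
      }
    ; equivariant = λ x → ι-cong (equivariant x)
    }
    where
    ι-injective : ∀ {y z} → Q.ι y Q.≈ Q.ι z → y Q.≈ z
    ι-injective {y} {z} eq = Q.Eq.trans (Q.Eq.sym (Q.ι-involutive y))
      (Q.Eq.trans (ι-cong eq) (Q.ι-involutive z))

    ι-cancel : ∀ {y z} → Q.ι y Q.≤ Q.ι z → y Q.≤ z
    ι-cancel {y} {z} le = Q.trans (Q.reflexive (Q.Eq.sym (Q.ι-involutive y)))
      (Q.trans (Q.ι-monotone le) (Q.reflexive (Q.ι-involutive z)))

-- Edges as minimal boxes, and thin boxes

BoxIso : Graph ℓ → Graph ℓ → Set _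
BoxIso G H = ℤ₂PosetIso (BoxComplex G) (BoxComplex H)

module _ {G : Graph ℓ} where
  open Graph G
  open Box

  atom : ∀ {x y} → E x y → Box G
  atom {x} {y} e = record
    { σ = _≡ x ; τ = _≡ y
    ; σ-nonempty = x , refl ; τ-nonempty = y , refl
    ; complete = λ { (refl , refl) → e }
    }

  span : (b : Box G) → ∀ {x x′ y y′} →
         σ b x → σ b x′ → τ b y → τ b y′ → Box G
  span b {x} {x′} {y} {y′} p p′ q q′ = record
    { σ = λ z → z ≡ x ⊎ z ≡ x′ ; τ = λ z → z ≡ y ⊎ z ≡ y′
    ; σ-nonempty = x , inj₁ refl ; τ-nonempty = y , inj₁ refl
    ; complete = λ (r , s) → complete b
        ( [ (λ { refl → p }) , (λ { refl → p′ }) ] r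
        , [ (λ { refl → q }) , (λ { refl → q′ }) ] s)
    }

  -- Classically, this means that one of the two sides is a singleton. The pairwise form can be
  -- transported without deciding which side it is.
  Thin : Box G → Set _
  Thin b = ∀ {x x′ y y′} → σ b x → σ b x′ → τ b y → τ b y′ → x ≡ x′ ⊎ y ≡ y′

  atom-≤ : ∀ {x y} {e : E x y} (b : Box G) → σ b x → τ b y → _≤ᴮ_ G (atom e) b
  atom-≤ b p q = (λ { refl → p }) , (λ { refl → q })

-- Transport of edges along an isomorphism

module Edges (G H : Graph ℓ) (I : BoxIso G H) where
  private
    module G = Graph G
    module H = Graph H
    module I = Isomorphism I
  open Box
  open I using (⟦_⟧; ⟦_⟧⁻¹)

  record _↦_ {x y u w} (e : G.E x y) (d : H.E u w) : Set ℓ where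
    constructor maps
    field atom-≈ : _≈ᴮ_ H ⟦ atom e ⟧ (atom d)
  open _↦_ public

  abstract
    -- Atoms are minimal: an edge `d` chosen inside the image pulls back to a box below `atom e`,
    -- which must be all of `atom e`, so the image is no larger than `atom d`.
    image : ∀ {x y} (e : G.E x y) → ∃₂ λ u w → Σ (H.E u w) λ d → e ↦ d
    image e = u , w , d , maps ((proj₁ above , proj₁ below) , (proj₂ above , proj₂ below))
      where
      b : Box H
      b = ⟦ atom e ⟧
      u w : H.V
      u = proj₁ (σ-nonempty b)
      w = proj₁ (τ-nonempty b)
      d : H.E u w
      d = complete b (proj₂ (σ-nonempty b) , proj₂ (τ-nonempty b))
      below : _≤ᴮ_ H (atom d) b
      below = atom-≤ {e = d} b (proj₂ (σ-nonempty b)) (proj₂ (τ-nonempty b))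
      a : Box G
      a = ⟦ atom d ⟧⁻¹
      a≤e : _≤ᴮ_ G a (atom e)
      a≤e = I.cancel {a} {atom e}
        (proj₁ below ∘ proj₁ (proj₁ (I.inverseˡ (atom d)))
        , proj₂ below ∘ proj₁ (proj₂ (I.inverseˡ (atom d))))
      e≤a : _≤ᴮ_ G (atom e) a
      e≤a = atom-≤ {e = e} a
        (subst (σ a) (proj₁ a≤e (proj₂ (σ-nonempty a))) (proj₂ (σ-nonempty a)))
        (subst (τ a) (proj₂ a≤e (proj₂ (τ-nonempty a))) (proj₂ (τ-nonempty a)))
      above : _≤ᴮ_ H b (atom d)
      above = proj₁ (proj₁ (I.inverseˡ (atom d))) ∘ proj₁ (I.mono {atom e} {a} e≤a)
            , proj₁ (proj₂ (I.inverseˡ (atom d))) ∘ proj₂ (I.mono {atom e} {a} e≤a)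

  module _ {x y u w} {e : G.E x y} {d : H.E u w} (m : e ↦ d) where

    abstract
      ↦-mono : (b : Box G) → σ b x → τ b y → σ ⟦ b ⟧ u × τ ⟦ b ⟧ w
      ↦-mono b p q = proj₁ le (proj₂ (proj₁ (atom-≈ m)) refl) , proj₂ le (proj₂ (proj₂ (atom-≈ m)) refl)
        where
        le : _≤ᴮ_ H ⟦ atom e ⟧ ⟦ b ⟧
        le = I.mono {atom e} {b} (atom-≤ {e = e} b p q)

      ↦-cancel : (b : Box G) → σ ⟦ b ⟧ u → τ ⟦ b ⟧ w → σ b x × τ b y
      ↦-cancel b p q = proj₁ le refl , proj₂ le refl
        where
        le : _≤ᴮ_ G (atom e) b
        le = I.cancel {atom e} {b}
          ( proj₁ (atom-≤ {e = d} ⟦ b ⟧ p q) ∘ proj₁ (proj₁ (atom-≈ m))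
          , proj₂ (atom-≤ {e = d} ⟦ b ⟧ p q) ∘ proj₁ (proj₂ (atom-≈ m)))

      -- As soon as the endpoints agree, `e` lies in `atom e′`, whatever the two proofs are, and the
      -- image of `atom e′` has singleton sides.
      ↦-functional : ∀ {x′ y′ u′ w′} {e′ : G.E x′ y′} {d′ : H.E u′ w′} → e′ ↦ d′ →
                     x ≡ x′ → y ≡ y′ → u ≡ u′ × w ≡ w′
      ↦-functional {e′ = e′} m′ p q =
        Product.map (proj₁ (proj₁ (atom-≈ m′))) (proj₁ (proj₂ (atom-≈ m′))) (↦-mono (atom e′) p q)

module Preimages (G H : Graph ℓ) (I : BoxIso G H) where
  private
    module G = Graph G
    module H = Graph H
    module I = Isomorphism I
    module J = Edges H G I.invert
  open Box
  open I using (⟦_⟧; ⟦_⟧⁻¹)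
  open Edges G H I

  abstract
    preimage : ∀ {u w} (d : H.E u w) → ∃₂ λ x y → Σ (G.E x y) λ e → e ↦ d
    preimage d with x , y , e , m ← J.image d =
      x , y , e , maps (Isomorphism.transpose-≈ I.invert {atom d} {atom e} (J.atom-≈ m))

    ↦-mono⁻¹ : ∀ {x y u w} {e : G.E x y} {d : H.E u w} → e ↦ d →
               (b : Box H) → σ b u → τ b w → σ ⟦ b ⟧⁻¹ x × τ ⟦ b ⟧⁻¹ y
    ↦-mono⁻¹ {e = e} {d} m = J.↦-mono {e = d} {e} (J.maps (I.transpose-≈ {atom e} {atom d} (atom-≈ m)))

  -- Two edges of a thin box agree in a coordinate, so they span a box without
  -- further edges, whereas edges that differ in both coordinates span one with four.
  thin-image : (b : Box G) → Thin b → Thin ⟦ b ⟧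
  thin-image b thin {u} {u′} {w} {w′} p p′ q q′
    with x₁ , y₁ , e₁ , m₁ ← preimage (complete ⟦ b ⟧ (p , q))
       | x₂ , y₂ , e₂ , m₂ ← preimage (complete ⟦ b ⟧ (p′ , q′))
       | x₃ , y₃ , e₃ , m₃ ← preimage (complete ⟦ b ⟧ (p , q′)) =
    [ (λ (r , s) → inj₂ (sym (proj₂ (↦-functional m₃ m₁ r s))))
    , (λ (r , s) → inj₁ (proj₁ (↦-functional m₃ m₂ r s))) ]
    (coincide (thin (proj₁ in₁) (proj₁ in₂) (proj₂ in₁) (proj₂ in₂)) (proj₁ in₃) (proj₂ in₃))
    where
    in₁ = ↦-cancel m₁ b p q
    in₂ = ↦-cancel m₂ b p′ q′
    s = span b (proj₁ in₁) (proj₁ in₂) (proj₂ in₁) (proj₂ in₂)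
    -- The mixed pair takes `u` from the first edge and `w′` from the second, and both edges lie in
    -- the image of `s`.
    in₃ = ↦-cancel m₃ s (proj₁ (↦-mono m₁ s (inj₁ refl) (inj₁ refl)))
                        (proj₂ (↦-mono m₂ s (inj₂ refl) (inj₂ refl)))
    coincide : x₁ ≡ x₂ ⊎ y₁ ≡ y₂ → x₃ ≡ x₁ ⊎ x₃ ≡ x₂ → y₃ ≡ y₁ ⊎ y₃ ≡ y₂ →
               (x₃ ≡ x₁ × y₃ ≡ y₁) ⊎ (x₃ ≡ x₂ × y₃ ≡ y₂)
    coincide (inj₁ refl) r (inj₁ t) = inj₁ (reduce r , t)
    coincide (inj₁ refl) r (inj₂ t) = inj₂ (reduce r , t)
    coincide (inj₂ refl) (inj₁ r) t = inj₁ (r , reduce t)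
    coincide (inj₂ refl) (inj₂ r) t = inj₂ (r , reduce t)

-- Stars of vertices

Serial : Graph ℓ → Set ℓ
Serial G = ∀ v → Satisfiable (Graph.N G v)

serial : ExcludedMiddle ℓ → (G : Graph ℓ) → NoIsolatedVertices G → Serial G
serial em G noIsolated v with em {P = Satisfiable (Graph.N G v)}
... | yes w = w
... | no ¬w = contradiction (λ w e → ¬w (w , e)) (noIsolated v)

module _ (G : Graph ℓ) (nbr : Serial G) where
  open Graph G

  star : V → Box G
  star x = record
    { σ = _≡ x ; τ = N x
    ; σ-nonempty = x , refl ; τ-nonempty = nbr x
    ; complete = λ { (refl , e) → e }
    }

  star-thin : ∀ x → Thin (star x)
  star-thin x p p′ _ _ = inj₁ (trans p (sym p′))

  flip-star-thin : ∀ x → Thin (flip G (star x))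
  flip-star-thin x _ _ q q′ = inj₂ (trans q (sym q′))

-- Images of stars: aligned and reversed

module Stars (em : ExcludedMiddle ℓ) (G H : Graph ℓ) (nbrᴳ : Serial G) (nbrᴴ : Serial H)
             (I : BoxIso G H) where
  private
    module G = Graph G
    module H = Graph H
    module I = Isomorphism I
    G★ = star G nbrᴳ
    H★ = star H nbrᴴ
  open Box
  open I using (⟦_⟧; ⟦_⟧⁻¹)
  open Edges G H I
  open Preimages G H I

  -- The negated clause makes `Image` single-valued: on a component that is one edge with distinct
  -- ends, the image of a star is aligned with one vertex and reversed with another.
  Aligned Reversed Image : G.V → H.V → Set _
  Aligned  x u = _≈ᴮ_ H ⟦ G★ x ⟧ (H★ u)
  Reversed x u = _≈ᴮ_ H ⟦ G★ x ⟧ (flip H (H★ u))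
  Image    x u = Aligned x u ⊎ (Reversed x u × ¬ ∃ (Aligned x))

  -- The second side of the image consists of neighbours of `u`. If none is missing, the image is
  -- the star of `u`; a missing one forces the image to be a single edge whose other end is a leaf.
  star-image-σ : ∀ {x u} → (∀ {z} → σ ⟦ G★ x ⟧ z → z ≡ u) → ∃ λ v → Aligned x v ⊎ Reversed x v
  star-image-σ {x} {u} σ⊆u with em {P = ∃ λ w′ → H.E u w′ × ¬ τ ⟦ G★ x ⟧ w′}
  ... | no none = u , inj₁ ((σ⊆u , λ { refl → u∈σ }) , ((λ q → complete b (u∈σ , q)) , N⊆τ))
    where
    b = ⟦ G★ x ⟧
    u∈σ : σ b u
    u∈σ = subst (σ b) (σ⊆u (proj₂ (σ-nonempty b))) (proj₂ (σ-nonempty b))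
    N⊆τ : ∀ {z} → H.E u z → τ b z
    N⊆τ {z} d with em {P = τ b z}
    ... | yes q = q
    ... | no ¬q = contradiction (z , d , ¬q) none
  -- Here x turns out to be a leaf, whose star is the edge xq with q of larger
  -- degree, and u is the endpoint that corresponds to q.
  ... | yes (w′ , d′ , w′∉τ)
    with w , w∈τ ← τ-nonempty ⟦ G★ x ⟧
    with p , q , e′ , m′ ← preimage d′ =
    w , inj₂ ((σ⊆N , N⊆σ) , (τ⊆w , λ { refl → w∈τ }))
    where
    b = ⟦ G★ x ⟧
    u∈σ : σ b u
    u∈σ = subst (σ b) (σ⊆u (proj₂ (σ-nonempty b))) (proj₂ (σ-nonempty b))
    p≢x : p ≢ x
    p≢x refl = w′∉τ (proj₂ (↦-mono m′ (G★ x) refl e′))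
    x≤ : _≤ᴮ_ G (G★ x) ⟦ H★ u ⟧⁻¹
    x≤ = I.transpose-≤ {G★ x} {H★ u} (σ⊆u , λ r → complete b (u∈σ , r))
    p≤ : σ ⟦ H★ u ⟧⁻¹ p × τ ⟦ H★ u ⟧⁻¹ q
    p≤ = ↦-mono⁻¹ m′ (H★ u) refl d′
    -- The thin box `⟦ H★ u ⟧⁻¹` contains the edges `x`-`y` and `p`-`q`. Their first ends differ, so
    -- their second ends agree.
    N⊆q : ∀ {y} → G.E x y → y ≡ q
    N⊆q e = [ (λ x≡p → contradiction (sym x≡p) p≢x) , id ]
      (Preimages.thin-image H G I.invert (H★ u) (star-thin H nbrᴴ u)
        (proj₁ x≤ refl) (proj₁ p≤) (proj₂ x≤ e) (proj₂ p≤))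
    τ⊆w : ∀ {z} → τ b z → z ≡ w
    τ⊆w z∈τ
      with x₁ , y₁ , e₁ , m₁ ← preimage (complete b (u∈σ , z∈τ))
         | x₂ , y₂ , e₂ , m₂ ← preimage (complete b (u∈σ , w∈τ)) =
      proj₂ (↦-functional m₁ m₂ (trans (proj₁ in₁) (sym (proj₁ in₂)))
        (trans (N⊆q (proj₂ in₁)) (sym (N⊆q (proj₂ in₂)))))
      where
      in₁ = ↦-cancel m₁ (G★ x) u∈σ z∈τ
      in₂ = ↦-cancel m₂ (G★ x) u∈σ w∈τ
    σ⊆N : ∀ {z} → σ b z → H.E w z
    σ⊆N r = H.E-sym (complete b (r , w∈τ))
    -- For a further neighbour `u′` of `w`, the preimage of `u′`-`w` would also end in `q`. The
    -- image of the thin box `flip G (G★ q)` would then contain `u′`-`w` and `u`-`w′`, which differ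
    -- in both coordinates.
    N⊆u : ∀ {u′} → H.E w u′ → u′ ≡ u
    N⊆u {u′} d with em {P = u′ ≡ u}
    ... | yes u′≡u = u′≡u
    ... | no u′≢u
      with x₁ , y₁ , e₁ , m₁ ← preimage (complete b (u∈σ , w∈τ))
         | x₂ , y₂ , e₂ , m₂ ← preimage (H.E-sym d)
      with refl , xy₁ ← ↦-cancel m₁ (G★ x) u∈σ w∈τ
      with refl ← N⊆q xy₁ = contradiction
        (thin-image (flip G (G★ q)) (flip-star-thin G nbrᴳ q)
          (proj₁ in₂) (proj₁ in′) (proj₂ in₂) (proj₂ in′))
        disjoint
      where
      w★ = flip H (H★ w)
      pre₁ = ↦-mono⁻¹ m₁ w★ (H.E-sym (complete b (u∈σ , w∈τ))) refl
      pre₂ = ↦-mono⁻¹ m₂ w★ d refl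
      y₂≡q : y₂ ≡ q
      y₂≡q with Preimages.thin-image H G I.invert w★ (flip-star-thin H nbrᴴ w)
        (proj₁ pre₁) (proj₁ pre₂) (proj₂ pre₁) (proj₂ pre₂)
      ... | inj₁ refl = N⊆q e₂
      ... | inj₂ q≡y₂ = sym q≡y₂
      in₂ = ↦-mono m₂ (flip G (G★ q)) (G.E-sym (subst (G.E x₂) y₂≡q e₂)) y₂≡q
      in′ = ↦-mono m′ (flip G (G★ q)) (G.E-sym e′) refl
      disjoint : ¬ (u′ ≡ u ⊎ w ≡ w′)
      disjoint (inj₁ u′≡u) = u′≢u u′≡u
      disjoint (inj₂ refl) = w′∉τ w∈τ
    N⊆σ : ∀ {z} → H.E w z → σ b z
    N⊆σ d = subst (σ b) (sym (N⊆u d)) u∈σ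

  -- Here `x` and `x′` have only each other as neighbours. The image of the star is then a single
  -- edge starting at `w`, and every edge from `w` pulls back into the star of `x`.
  isolatedEdge-aligned : ∀ {x x′ u} → _≈ᴮ_ G (G★ x) (flip G (G★ x′)) → Reversed x u →
                         ∃ (Aligned x)
  isolatedEdge-aligned {x} {x′} {u} x≈x′ rev
    with w , v , d , m ← image (proj₂ (proj₂ x≈x′) refl)
    with refl ← proj₁ (proj₂ rev) (proj₂ (↦-mono m (G★ x) refl (proj₂ (proj₂ x≈x′) refl))) =
    w , (σ⊆w , λ { refl → proj₁ wu∈b }) , (τ⊆N , N⊆τ)
    where
    b = ⟦ G★ x ⟧
    e : G.E x x′
    e = proj₂ (proj₂ x≈x′) refl
    wu∈b = ↦-mono m (G★ x) refl e
    b≤ : _≤ᴮ_ H b ⟦ atom e ⟧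
    b≤ = I.mono {G★ x} {atom e} (id , proj₁ (proj₂ x≈x′))
    σ⊆w : ∀ {z} → σ b z → z ≡ w
    σ⊆w = proj₁ (proj₁ (atom-≈ m)) ∘ proj₁ b≤
    τ⊆N : ∀ {z} → τ b z → H.E w z
    τ⊆N r = complete b (proj₁ wu∈b , r)
    -- The preimage of `H★ w` contains `x`-`x′` and `p`-`q`, so `p` is adjacent to `x′`, hence equal
    -- to `x`, and `x` is adjacent to `q`.
    N⊆τ : ∀ {z} → H.E w z → τ b z
    N⊆τ d′ with p , q , e′ , m′ ← preimage d′ =
      proj₂ (↦-mono m′ (G★ x)
        (proj₂ (proj₁ x≈x′) (G.E-sym (complete w★⁻¹ (proj₁ pq , proj₂ xx′))))
        (complete w★⁻¹ (proj₁ xx′ , proj₂ pq)))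
      where
      w★⁻¹ = ⟦ H★ w ⟧⁻¹
      xx′ = ↦-mono⁻¹ m (H★ w) refl d
      pq = ↦-mono⁻¹ m′ (H★ w) refl d′

  -- By equivariance and injectivity the stars of `x` and `y` are flips of each other, so `y` lies
  -- on an isolated edge or loop.
  aligned-reversed : ∀ {x y s} → Aligned x s → Reversed y s → ∃ (Aligned y)
  aligned-reversed {x} {y} {s} al rev = isolatedEdge-aligned y≈x rev
    where
    x≈ = I.equivariant (G★ x)
    y≈x : _≈ᴮ_ G (G★ y) (flip G (G★ x))
    y≈x = I.injective {G★ y} {flip G (G★ x)}
      ( (proj₂ (proj₁ x≈) ∘ proj₂ (proj₂ al) ∘ proj₁ (proj₁ rev)
        , proj₂ (proj₁ rev) ∘ proj₁ (proj₂ al) ∘ proj₁ (proj₁ x≈))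
      , (proj₂ (proj₂ x≈) ∘ proj₂ (proj₁ al) ∘ proj₁ (proj₂ rev)
        , proj₂ (proj₂ rev) ∘ proj₁ (proj₁ al) ∘ proj₁ (proj₂ x≈)))

  Image-functional : ∀ {x u v} → Image x u → Image x v → u ≡ v
  Image-functional (inj₁ a) (inj₁ a′) = proj₁ (proj₁ a′) (proj₂ (proj₁ a) refl)
  Image-functional (inj₁ a) (inj₂ (_ , ¬a)) = contradiction (_ , a) ¬a
  Image-functional (inj₂ (_ , ¬a)) (inj₁ a) = contradiction (_ , a) ¬a
  Image-functional (inj₂ (r , _)) (inj₂ (r′ , _)) = proj₁ (proj₂ r′) (proj₂ (proj₂ r) refl)

  -- The image edge `u`-`w` lies in the image of the star of `x` and, flipped, in that of the star
  -- of `y`. Two aligned stars yield this edge and two reversed ones its opposite. In a mixed pair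
  -- `s` and `t` would coincide, and `aligned-reversed` contradicts the preference for alignment.
  Image-edge : ∀ {x y s t} → Image x s → Image y t → G.E x y → H.E s t
  Image-edge {x} {y} is it e with u , w , d , m ← image e = go is it
    where
    at-x = ↦-mono m (G★ x) refl e
    y≈ = I.equivariant (G★ y)
    at-flip-y = ↦-mono m (flip G (G★ y)) (G.E-sym e) refl
    at-y : τ ⟦ G★ y ⟧ u × σ ⟦ G★ y ⟧ w
    at-y = proj₁ (proj₁ y≈) (proj₁ at-flip-y) , proj₁ (proj₂ y≈) (proj₂ at-flip-y)
    go : ∀ {s t} → Image x s → Image y t → H.E s t
    go (inj₁ a) (inj₁ a′) =
      subst₂ H.E (proj₁ (proj₁ a) (proj₁ at-x)) (proj₁ (proj₁ a′) (proj₂ at-y)) d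
    go (inj₂ (r , _)) (inj₂ (r′ , _)) = H.E-sym
      (subst₂ H.E (proj₁ (proj₂ r′) (proj₁ at-y)) (proj₁ (proj₂ r) (proj₂ at-x)) d)
    go (inj₁ a) (inj₂ (r , ¬a))
      with refl ← proj₁ (proj₁ a) (proj₁ at-x) | refl ← proj₁ (proj₂ r) (proj₁ at-y) =
      contradiction (aligned-reversed a r) ¬a
    go (inj₂ (r , ¬a)) (inj₁ a)
      with refl ← proj₁ (proj₁ a) (proj₂ at-y) | refl ← proj₁ (proj₂ r) (proj₂ at-x) =
      contradiction (aligned-reversed a r) ¬a

-- The vertex correspondence

module Vertices (em : ExcludedMiddle ℓ) (G H : Graph ℓ) (nbrᴳ : Serial G) (nbrᴴ : Serial H)
                (I : BoxIso G H) where
  private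
    module I = Isomorphism I
    module J = Stars em H G nbrᴴ nbrᴳ I.invert
    G★ = star G nbrᴳ
    H★ = star H nbrᴴ
  open Box
  open I using (⟦_⟧)
  open Stars em G H nbrᴳ nbrᴴ I

  -- If the first side has two elements, thinness makes the second a singleton. The twisted
  -- isomorphism then applies, with aligned and reversed trading places.
  star-image : ∀ x → ∃ λ u → Aligned x u ⊎ Reversed x u
  star-image x with σ-nonempty b | τ-nonempty b
    where b = ⟦ G★ x ⟧
  ... | u , u∈σ | w , w∈τ with em {P = ∃ λ u′ → σ ⟦ G★ x ⟧ u′ × u′ ≢ u}
  ... | no none = star-image-σ σ⊆u
    where
    σ⊆u : ∀ {z} → σ ⟦ G★ x ⟧ z → z ≡ u
    σ⊆u {z} z∈σ with em {P = z ≡ u}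
    ... | yes z≡u = z≡u
    ... | no z≢u = contradiction (z , z∈σ , z≢u) none
  ... | yes (u′ , u′∈σ , u′≢u) =
    Product.map₂ (λ { (inj₁ a) → inj₂ (swap a) ; (inj₂ r) → inj₁ (swap r) })
      (Stars.star-image-σ em G H nbrᴳ nbrᴴ I.twist τ⊆w)
    where
    τ⊆w : ∀ {z} → τ ⟦ G★ x ⟧ z → z ≡ w
    τ⊆w z∈τ = [ (λ u′≡u → contradiction u′≡u u′≢u) , id ]
      (Preimages.thin-image G H I (G★ x) (star-thin G nbrᴳ x) u′∈σ u∈σ z∈τ w∈τ)

  Image-total : ∀ x → ∃ (Image x)
  Image-total x with em {P = ∃ (Aligned x)} | star-image x
  ... | yes (u , a) | _ = u , inj₁ a
  ... | no ¬a | u , inj₁ a = contradiction (u , a) ¬a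
  ... | no ¬a | u , inj₂ r = u , inj₂ (r , ¬a)

  -- In the reversed case equivariance reverses the inverse as well. If the star of `u` also came
  -- from a star, that star would be aligned with `u`, and `aligned-reversed` would align `x`.
  Image-converse : ∀ {x u} → Image x u → J.Image u x
  Image-converse {x} {u} (inj₁ a) = inj₁ (I.transpose-≈ {G★ x} {H★ u} a)
  Image-converse {x} {u} (inj₂ (r , ¬a)) = inj₂ (r⁻¹ , λ (x′ , a′) →
      ¬a (aligned-reversed (Isomorphism.transpose-≈ I.invert {H★ u} {G★ x′} a′) r))
    where
    x≈ = I.equivariant (G★ x)
    r⁻¹ : J.Reversed u x
    r⁻¹ = I.transpose-≈ {flip G (G★ x)} {H★ u}
      ( (proj₁ (proj₂ r) ∘ proj₁ (proj₁ x≈) , proj₂ (proj₁ x≈) ∘ proj₂ (proj₂ r))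
      , (proj₁ (proj₁ r) ∘ proj₁ (proj₂ x≈) , proj₂ (proj₂ x≈) ∘ proj₂ (proj₁ r)))

-- `Image` is total and functional for both the isomorphism and its inverse, and the two relations
-- are converse to each other.
BoxIso⇒GraphIso : ExcludedMiddle ℓ → {G H : Graph ℓ} → Serial G → Serial H →
                  BoxIso G H → GraphIso G H
BoxIso⇒GraphIso em {G} {H} nbrᴳ nbrᴴ I = record
  { bijection = mk↔ₛ′ φ ψ
      (λ u → S.Image-functional (φ-image (ψ u)) (W.Image-converse (ψ-image u)))
      (λ x → T.Image-functional (ψ-image (φ x)) (V.Image-converse (φ-image x)))
  ; edges = λ x y → mk⇔ (S.Image-edge (φ-image x) (φ-image y))
      (T.Image-edge (V.Image-converse (φ-image x)) (V.Image-converse (φ-image y)))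
  }
  where
  J = Isomorphism.invert I
  module S = Stars em G H nbrᴳ nbrᴴ I
  module T = Stars em H G nbrᴴ nbrᴳ J
  module V = Vertices em G H nbrᴳ nbrᴴ I
  module W = Vertices em H G nbrᴴ nbrᴳ J
  φ = proj₁ ∘ V.Image-total
  ψ = proj₁ ∘ W.Image-total
  φ-image = proj₂ ∘ V.Image-total
  ψ-image = proj₂ ∘ W.Image-total

-- From graph isomorphisms to isomorphisms of box complexes

GraphIso⇒BoxIso : {G H : Graph ℓ} → GraphIso G H → BoxIso G H
GraphIso⇒BoxIso {G = G} {H} iso = record
  { ⟦_⟧ = push
  ; isOrderIsomorphism = record
    { isOrderMonomorphism = record
      { isOrderHomomorphism = record
        { cong = λ ((a , b) , (c , d)) → (a , b) , (c , d)
        ; mono = λ (a , c) → a , c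
        }
      ; injective = λ {b} {c} ((p , q) , (r , s)) →
          (reflect (σ b) (σ c) p , reflect (σ c) (σ b) q) ,
          (reflect (τ b) (τ c) r , reflect (τ c) (τ b) s)
      ; cancel = λ {b} {c} (p , r) → reflect (σ b) (σ c) p , reflect (τ b) (τ c) r
      }
    ; surjective = λ b → pull b , λ ((p , q) , (r , s)) →
        ( (λ {z} → subst (σ b) (strictlyInverseˡ z) ∘ p)
        , (λ {z} → q ∘ subst (σ b) (sym (strictlyInverseˡ z)))) ,
        ( (λ {z} → subst (τ b) (strictlyInverseˡ z) ∘ r)
        , (λ {z} → s ∘ subst (τ b) (sym (strictlyInverseˡ z))))
    }
  ; equivariant = λ _ → (id , id) , (id , id)
  }
  where
  module G = Graph G
  module H = Graph H
  open GraphIso iso using (bijection; to; from; edges)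
  open Inverse bijection using (strictlyInverseˡ; strictlyInverseʳ)
  open Box

  reflect : (A B : Pred G.V _) → (∀ {u} → A (from u) → B (from u)) → A ⊆ B
  reflect A B A⊆B {x} a = subst B (strictlyInverseʳ x)
    (A⊆B (subst A (sym (strictlyInverseʳ x)) a))

  -- Direct images under `to` are written as preimages under `from`, which avoids existentials and
  -- makes equivariance immediate.
  push : Box G → Box H
  push b = record
    { σ = σ b ∘ from
    ; τ = τ b ∘ from
    ; σ-nonempty = let x , p = σ-nonempty b in to x , subst (σ b) (sym (strictlyInverseʳ x)) p
    ; τ-nonempty = let x , p = τ-nonempty b in to x , subst (τ b) (sym (strictlyInverseʳ x)) p
    ; complete = λ {(u , w)} p → subst₂ H.E (strictlyInverseˡ u) (strictlyInverseˡ w)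
        (Equivalence.to (edges (from u) (from w)) (complete b p))
    }

  pull : Box H → Box G
  pull b = record
    { σ = σ b ∘ to
    ; τ = τ b ∘ to
    ; σ-nonempty = let u , p = σ-nonempty b in from u , subst (σ b) (sym (strictlyInverseˡ u)) p
    ; τ-nonempty = let u , p = τ-nonempty b in from u , subst (τ b) (sym (strictlyInverseˡ u)) p
    ; complete = λ {(x , y)} p → Equivalence.from (edges x y) (complete b p)
    }

theorem1p1 : ∀ {ℓ} → ExcludedMiddle ℓ →
    (G H : Graph ℓ) → NoIsolatedVertices G → NoIsolatedVertices H →
    GraphIso G H ⇔ ℤ₂PosetIso (BoxComplex G) (BoxComplex H)
theorem1p1 em G H noIsolatedᴳ noIsolatedᴴ =
  mk⇔ GraphIso⇒BoxIso (BoxIso⇒GraphIso em (serial em G noIsolatedᴳ) (serial em H noIsolatedᴴ))
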